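{- Let $\mathcal{T}$ be any rooted tree with $L$ leaves over a set $\mathcal{V}$ of nodes. Then \[ |\{v \in \mathcal{V} \mid \mathrm{depth}(v) < |\mathcal{L}(v)|\}| \le L, \] where $\mathrm{depth}(v)$ is the depth of node $v$ and $\mathcal{L}(v)$ is the set of leaf descendants of $v$.
   Context: Trees are finite. The depth of a node is the number of edges on the path from the root to it (so the root has depth $0$). A leaf is a node without children. Every node is considered a descendant of itself, so $\mathcal{L}(v)=\{v\}$ if $v$ is a leaf. -}

module Defs where

open import Data.Bool using (true)
open import Data.Fin using (Fin)
open import Data.Fin.Properties using (_≟_; all?)
open import Data.Fin.Subset using (Subset; _∈_)
open import Data.List using (List; []; _∷_)
import Data.List.Membership.Propositional as List
import Data.List.Membership.DecPropositional as DecList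
open import Data.List.Relation.Unary.Any using (here; there)
open import Data.Nat using (ℕ; zero; suc)
open import Data.Vec using (tabulate)
open import Data.Vec.Properties using (lookup∘tabulate; lookup⇒[]=; []=⇒lookup)
open import Function using (_∘_)
open import Function.Bundles using (_⇔_; mk⇔)
open import Level using (0ℓ)
open import Relation.Binary.Core using (Rel)
import Relation.Binary.Definitions as Binary
open import Relation.Binary.Construct.Closure.ReflexiveTransitive
  using (Star; ε; _◅_; _◅◅_)
open import Relation.Binary.PropositionalEquality using (_≡_; refl; sym; trans; subst)
open import Relation.Nullary using (Dec; yes; no; ¬_; does)
open import Relation.Nullary.Decidable
  using (map′; ¬?; _×-dec_; dec-true)
open import Relation.Unary using (Pred; Decidable)

module _ {n : ℕ} {P : Pred (Fin n) 0ℓ} where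

  -- The finite set { x | P x }; ∈⟦⟧⇔ is its membership rule.
  ⟦_⟧ : Decidable P → Subset n
  ⟦ P? ⟧ = tabulate (does ∘ P?)

  ∈⟦⟧⇔ : (P? : Decidable P) → ∀ {x} → x ∈ ⟦ P? ⟧ ⇔ P x
  ∈⟦⟧⇔ P? {x} = mk⇔
    (λ x∈ → witness (P? x)
       (trans (sym (lookup∘tabulate (does ∘ P?) x)) ([]=⇒lookup x∈)))
    (λ px → lookup⇒[]= x _
       (trans (lookup∘tabulate (does ∘ P?) x) (dec-true (P? x) px)))
    where
    witness : ∀ {A : Set} (a? : Dec A) → does a? ≡ true → A
    witness (yes a) _  = a
    witness (no  _) ()

module _ {A : Set} {E : Rel A 0ℓ} where

  length : ∀ {u v} → Star E u v → ℕ
  length ε       = zero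
  length (_ ◅ p) = suc (length p)

  vertices : ∀ {u v} → Star E u v → List A
  vertices {u} ε       = u ∷ []
  vertices {u} (_ ◅ p) = u ∷ vertices p

  source∈ : ∀ {u v} (p : Star E u v) → u List.∈ vertices p
  source∈ ε       = here refl
  source∈ (_ ◅ _) = here refl

  ∈-++ʳ : ∀ {u v w x} (p : Star E u v) {q : Star E v w} →
          x List.∈ vertices q → x List.∈ vertices (p ◅◅ q)
  ∈-++ʳ ε       x∈ = x∈
  ∈-++ʳ (_ ◅ p) x∈ = there (∈-++ʳ p x∈)

  suffix : ∀ {u v x} (p : Star E u v) → x List.∈ vertices p → Star E x v
  suffix ε       (here refl) = ε
  suffix (e ◅ p) (here refl) = e ◅ p
  suffix (_ ◅ p) (there x∈)  = suffix p x∈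

-- A finite rooted tree on the node set Fin n, with edges directed from
-- parent to child: every node is reached from the root by exactly one
-- directed walk.  This rules out cycles, second parents and unreachable
-- nodes; it also makes _↦_ proof-irrelevant, so there are no parallel edges.
record RootedTree (n : ℕ) : Set₁ where
  infix 4 _↦_ _↦?_
  field
    root   : Fin n
    _↦_    : Rel (Fin n) 0ℓ
    _↦?_   : Binary.Decidable _↦_
    path   : ∀ v → Star _↦_ root v
    unique : ∀ {v} (p q : Star _↦_ root v) → p ≡ q

  depth : Fin n → ℕ
  depth v = length (path v)

  IsLeaf : Pred (Fin n) 0ℓ
  IsLeaf v = ∀ w → ¬ (v ↦ w)

  isLeaf? : Decidable IsLeaf
  isLeaf? v = all? λ w → ¬? (v ↦? w)

  leaves : Subset n
  leaves = ⟦ isLeaf? ⟧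

  _IsDescendantOf_ : Rel (Fin n) 0ℓ
  w IsDescendantOf v = Star _↦_ v w

  -- Reachability is decided by looking for v on the unique path to w.
  _isDescendantOf?_ : Binary.Decidable _IsDescendantOf_
  w isDescendantOf? v = map′
    (suffix (path w))
    (λ p → subst (λ q → v List.∈ vertices q) (unique (path v ◅◅ p) (path w))
             (∈-++ʳ (path v) (source∈ p)))
    (DecList._∈?_ _≟_ v (vertices (path w)))

  𝓛 : Fin n → Subset n
  𝓛 v = ⟦ (λ w → (w isDescendantOf? v) ×-dec isLeaf? w) ⟧

{-# OPTIONS --safe #-}

-- Number the nodes arbitrarily and let v, when depth v < |𝓛 v|, choose the leaf
-- of 𝓛 v with exactly depth v smaller leaves in 𝓛 v.  The choice is injective:
-- two nodes choosing the same leaf w are both ancestors of w, hence comparable,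
-- and if u is an ancestor of v then 𝓛 v ⊆ 𝓛 u, so that
-- depth v = rank of w in 𝓛 v ≤ rank of w in 𝓛 u = depth u, which forces u = v.
module Submission where

open import Defs
open import Data.Bool using (true; false)
open import Data.Fin using (Fin; zero; suc)
open import Data.Fin.Properties using (suc-injective)
open import Data.Fin.Subset using (Subset; ∣_∣; _∈_; _⊆_; _-_)
open import Data.Fin.Subset.Properties
  using (drop-∷-⊆; x∈p∧x≢y⇒x∈p-y; x∈p⇒∣p-x∣<∣p∣)
import Data.List.Membership.Propositional as List
open import Data.List.Relation.Unary.Any using (here; there)
open import Data.Nat using (ℕ; zero; suc; _+_; _≤_; _<_; _<?_; z≤n; s≤s; s<s⁻¹)
open import Data.Nat.Properties using (≤-trans; ≤-reflexive; m≤n⇒m≤1+n; m+1+n≰m)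
open import Data.Product using (∃; _×_; _,_; proj₁; proj₂; map₂)
open import Data.Sum using (_⊎_; inj₁; inj₂)
open import Data.Vec using ([]; _∷_; here; there)
open import Function using (_∘_)
open import Function.Bundles using (_⇔_; Equivalence)
open import Level using (0ℓ)
open import Relation.Binary.Core using (Rel; REL)
open import Relation.Binary.Construct.Closure.ReflexiveTransitive
  using (Star; ε; _◅_; _◅◅_)
open import Relation.Binary.PropositionalEquality
  using (_≡_; refl; sym; trans; cong; subst)
open import Relation.Nullary using (contradiction)
open import Relation.Nullary.Decidable using (_×-dec_)

-- Each element of `p` uses up its partner in `q`, leaving the rest of `p` to be matched into the
-- smaller set `q - y`. A relation replaces a function because partners are produced from membership
-- proofs; injectivity then never compares such proofs.
∣∣-mono-injection : ∀ {m n} (p : Subset m) (q : Subset n) (R : REL (Fin m) (Fin n) 0ℓ) →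
                    (∀ {x} → x ∈ p → ∃ λ y → y ∈ q × R x y) →
                    (∀ {x x′ y} → R x y → R x′ y → x ≡ x′) →
                    ∣ p ∣ ≤ ∣ q ∣
∣∣-mono-injection []          q R f inj = z≤n
∣∣-mono-injection (false ∷ p) q R f inj =
  ∣∣-mono-injection p q (R ∘ suc) (f ∘ there) λ r r′ → suc-injective (inj r r′)
∣∣-mono-injection (true ∷ p)  q R f inj with f here
... | y , y∈q , r = ≤-trans
  (s≤s (∣∣-mono-injection p (q - y) (R ∘ suc) f′ λ r r′ → suc-injective (inj r r′)))
  (x∈p⇒∣p-x∣<∣p∣ y∈q)
  where
  f′ : ∀ {x} → x ∈ p → ∃ λ z → z ∈ q - y × R (suc x) z
  f′ x∈p with f (there x∈p)
  ... | z , z∈q , r′ =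
    -- If `z` were `y`, injectivity would identify `zero` with `suc x`.
    z , x∈p∧x≢y⇒x∈p-y z∈q (λ { refl → contradiction (inj r r′) λ () }) , r′

-- Only strictly smaller members are counted, so the members of `p` have ranks from 0 to `∣ p ∣`
-- minus 1.
rank : ∀ {n} → Subset n → Fin n → ℕ
rank (_     ∷ _) zero    = zero
rank (true  ∷ p) (suc x) = suc (rank p x)
rank (false ∷ p) (suc x) = rank p x

rank-mono : ∀ {n} {p q : Subset n} → p ⊆ q → ∀ x → rank p x ≤ rank q x
rank-mono {p = _     ∷ _} {_     ∷ _} p⊆q zero    = z≤n
rank-mono {p = false ∷ _} {false ∷ _} p⊆q (suc x) = rank-mono (drop-∷-⊆ p⊆q) x
rank-mono {p = false ∷ _} {true  ∷ _} p⊆q (suc x) = m≤n⇒m≤1+n (rank-mono (drop-∷-⊆ p⊆q) x)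
rank-mono {p = true  ∷ _} {true  ∷ _} p⊆q (suc x) = s≤s (rank-mono (drop-∷-⊆ p⊆q) x)
rank-mono {p = true  ∷ _} {false ∷ _} p⊆q (suc x) = contradiction (p⊆q here) λ ()

rank-surjective : ∀ {n} (p : Subset n) {k} → k < ∣ p ∣ → ∃ λ x → x ∈ p × rank p x ≡ k
rank-surjective (false ∷ p) k<∣p∣ with rank-surjective p k<∣p∣
... | x , x∈p , eq = suc x , there x∈p , eq
rank-surjective (true ∷ p) {zero}  _     = zero , here , refl
rank-surjective (true ∷ p) {suc k} k<∣p∣ with rank-surjective p (s<s⁻¹ k<∣p∣)
... | x , x∈p , eq = suc x , there x∈p , cong suc eq

module _ {A : Set} {E : Rel A 0ℓ} where

  length-◅◅ : ∀ {u v w} (p : Star E u v) (q : Star E v w) →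
              length (p ◅◅ q) ≡ length p + length q
  length-◅◅ ε       q = refl
  length-◅◅ (_ ◅ p) q = cong suc (length-◅◅ p q)

  prefix : ∀ {u v x} (p : Star E u v) → x List.∈ vertices p → Star E u x
  prefix ε       (here refl) = ε
  prefix (_ ◅ _) (here refl) = ε
  prefix (e ◅ p) (there x∈)  = e ◅ prefix p x∈

  -- Strip edges until one of the two vertices is the source; the remaining walk leads from it to
  -- the other.
  vertices-comparable : ∀ {u v x y} (p : Star E u v) →
                        x List.∈ vertices p → y List.∈ vertices p →
                        Star E x y ⊎ Star E y x
  vertices-comparable ε       (here refl) y∈          = inj₁ (prefix ε y∈)
  vertices-comparable (e ◅ p) (here refl) y∈          = inj₁ (prefix (e ◅ p) y∈)
  vertices-comparable (e ◅ p) (there x∈)  (here refl) = inj₂ (prefix (e ◅ p) (there x∈))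
  vertices-comparable (_ ◅ p) (there x∈)  (there y∈)  = vertices-comparable p x∈ y∈

module _ {n : ℕ} (T : RootedTree n) where
  open RootedTree T

  ∈𝓛⇔ : ∀ v {w} → w ∈ 𝓛 v ⇔ (w IsDescendantOf v × IsLeaf w)
  ∈𝓛⇔ v = ∈⟦⟧⇔ λ w → (w isDescendantOf? v) ×-dec isLeaf? w

  𝓛⊆leaves : ∀ {v} → 𝓛 v ⊆ leaves
  𝓛⊆leaves {v} w∈ = Equivalence.from (∈⟦⟧⇔ isLeaf?) (proj₂ (Equivalence.to (∈𝓛⇔ v) w∈))

  𝓛-antitone : ∀ {u v} → v IsDescendantOf u → 𝓛 v ⊆ 𝓛 u
  𝓛-antitone {u} {v} p w∈ with Equivalence.to (∈𝓛⇔ v) w∈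
  ... | q , leaf = Equivalence.from (∈𝓛⇔ u) (p ◅◅ q , leaf)

  -- The walk from the root to `v` and on to `w` is `path w`, by uniqueness.
  ancestor∈path : ∀ {v w} → w IsDescendantOf v → v List.∈ vertices (path w)
  ancestor∈path {v} {w} p = subst (λ q → v List.∈ vertices q)
    (unique (path v ◅◅ p) (path w)) (∈-++ʳ (path v) (source∈ p))

  ancestors-comparable : ∀ {u v w} → w IsDescendantOf u → w IsDescendantOf v →
                         v IsDescendantOf u ⊎ u IsDescendantOf v
  ancestors-comparable {w = w} p q =
    vertices-comparable (path w) (ancestor∈path p) (ancestor∈path q)

  -- By uniqueness `path v` is `path u` followed by the walk from `u` to `v`, so any edge on that
  -- walk makes `v` strictly deeper.
  descendant-no-deeper : ∀ {u v} → v IsDescendantOf u → depth v ≤ depth u → u ≡ v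
  descendant-no-deeper         ε         _  = refl
  descendant-no-deeper {u} {v} p@(_ ◅ _) d≤ = contradiction
    (subst (_≤ depth u) (trans (cong length (unique (path v) (path u ◅◅ p)))
                               (length-◅◅ (path u) p)) d≤)
    -- Since `p` is matched as nonempty, `length p` reduces to a successor.
    (m+1+n≰m (depth u))

  Chooses : Rel (Fin n) 0ℓ
  Chooses v w = w ∈ 𝓛 v × rank (𝓛 v) w ≡ depth v

  -- Moving down the tree can only shrink the leaf set, hence the rank of `w`; as both ranks equal
  -- depths, the depth cannot grow either.
  choosing-descendant : ∀ {u v w} → v IsDescendantOf u →
                        rank (𝓛 u) w ≡ depth u → rank (𝓛 v) w ≡ depth v → u ≡ v
  choosing-descendant {w = w} p eqᵤ eqᵥ = descendant-no-deeper p
    (≤-trans (≤-reflexive (sym eqᵥ))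
      (≤-trans (rank-mono (𝓛-antitone p) w) (≤-reflexive eqᵤ)))

  Chooses-injective : ∀ {u v w} → Chooses u w → Chooses v w → u ≡ v
  Chooses-injective {u} {v} (w∈ᵤ , eqᵤ) (w∈ᵥ , eqᵥ)
    -- Lying in both leaf sets, `w` is a common descendant of `u` and `v`.
    with ancestors-comparable (proj₁ (Equivalence.to (∈𝓛⇔ u) w∈ᵤ)) (proj₁ (Equivalence.to (∈𝓛⇔ v) w∈ᵥ))
  ... | inj₁ p = choosing-descendant p eqᵤ eqᵥ
  ... | inj₂ p = sym (choosing-descendant p eqᵥ eqᵤ)

  -- The strict bound says exactly that `depth v` is among the ranks attained in `𝓛 v`.
  Chooses-total : ∀ {v} → depth v < ∣ 𝓛 v ∣ → ∃ λ w → w ∈ leaves × Chooses v w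
  Chooses-total {v} d< = map₂ (λ (w∈ , eq) → 𝓛⊆leaves {v} w∈ , w∈ , eq)
                              (rank-surjective (𝓛 v) d<)

lemma2p1 : ∀ {n L : ℕ} (T : RootedTree n) → let open RootedTree T in
    ∣ leaves ∣ ≡ L →
    ∣ ⟦ (λ v → depth v <? ∣ 𝓛 v ∣) ⟧ ∣ ≤ L
lemma2p1 T refl = ∣∣-mono-injection _ _ (Chooses T)
  (λ v∈ → Chooses-total T (Equivalence.to (∈⟦⟧⇔ (λ v → depth v <? ∣ 𝓛 v ∣)) v∈))
  (Chooses-injective T)
  where open RootedTree T
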